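{- Let $F$ be an oriented star of degree $4$ and let $H$ be a digraph such that $\{H, F\}$ is $\vec{\chi}$-finite. Then either $H$ is a transitive tournament, or $H = \Delta(TT_1, TT_m, TT_{m'})$ for some integers $m, m' \geq 1$.
   Context: All digraphs are finite, loopless, and between any two distinct vertices at most one of the two possible arcs is present. A digraph $D$ is $H$-free if no induced subdigraph of $D$ is isomorphic to $H$, and $\mathcal{F}$-free if it is $H$-free for every $H\in\mathcal{F}$. The dichromatic number $\vec{\chi}(D)$ is the least $k$ such that $V(D)$ can be partitioned into $k$ sets each inducing an acyclic subdigraph. A finite family $\mathcal{F}$ is $\vec{\chi}$-finite if there is a constant $c$ such that every $\mathcal{F}$-free digraph has dichromatic number at most $c$. An oriented star of degree $t$ is an orientation of $K_{1,t}$. A tournament is an orientation of a complete graph; it is transitive if acyclic, and $TT_k$ denotes the transitive tournament on $k$ vertices. For digraphs $D_1, D_2, D_3$, $\Delta(D_1,D_2,D_3)$ is the digraph obtained from the disjoint union $D_1+D_2+D_3$ by adding all arcs $d_id_j$ with $d_i\in V(D_i)$, $d_j \in V(D_j)$ and $(i,j)\in\{(1,2),(2,3),(3,1)\}$. -}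

module Defs where

open import Data.Nat using (ℕ; zero; suc; _+_; _<ᵇ_; _≥_)
open import Data.Fin using (Fin; zero; suc; toℕ; inject₁; fromℕ; splitAt)
open import Data.Bool using (Bool; true; false)
open import Data.Sum using (_⊎_; inj₁; inj₂)
open import Data.Product using (Σ; _×_; _,_; ∃; ∃-syntax)
open import Relation.Nullary using (¬_)
open import Relation.Binary.PropositionalEquality using (_≡_; _≢_)
open import Function.Definitions using (Injective)
open import Function.Bundles using (_↔_; Inverse)

Digraph : ℕ → Set
Digraph n = Fin n → Fin n → Bool

Oriented : ∀ {n} → Digraph n → Set
Oriented {n} D = (∀ (x : Fin n) → D x x ≡ false)
               × (∀ (x y : Fin n) → D x y ≡ true → D y x ≡ false)

Contains : ∀ {h n} → Digraph h → Digraph n → Set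
Contains {h} {n} H D =
  Σ (Fin h → Fin n) λ f → Injective _≡_ _≡_ f × (∀ i j → D (f i) (f j) ≡ H i j)

Free : ∀ {h n} → Digraph h → Digraph n → Set
Free H D = ¬ Contains H D

Isomorphic : ∀ {h n} → Digraph h → Digraph n → Set
Isomorphic {h} {n} H D =
  Σ (Fin h ↔ Fin n) λ e → ∀ i j → D (Inverse.to e i) (Inverse.to e j) ≡ H i j

CycleIn : ∀ {n} → Digraph n → (Fin n → Set) → Set
CycleIn {n} D P =
  Σ ℕ λ l → Σ (Fin (suc (suc l)) → Fin n) λ g →
    Injective _≡_ _≡_ g
    × (∀ i → P (g i))
    × (∀ (i : Fin (suc l)) → D (g (inject₁ i)) (g (suc i)) ≡ true)
    × (D (g (fromℕ (suc l))) (g zero) ≡ true)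

Acyclic : ∀ {n} → Digraph n → Set
Acyclic D = ¬ CycleIn D (λ _ → Data.Unit.⊤)
  where import Data.Unit

DichromaticAtMost : ∀ {n} → Digraph n → ℕ → Set
DichromaticAtMost {n} D k =
  Σ (Fin n → Fin k) λ col → ∀ (c : Fin k) → ¬ CycleIn D (λ v → col v ≡ c)

ChiFinite₂ : ∀ {h f} → Digraph h → Digraph f → Set
ChiFinite₂ H F =
  ∃[ c ] ∀ (n : ℕ) (D : Digraph n) → Oriented D → Free H D → Free F D → DichromaticAtMost D c

IsOrientedStar4 : Digraph 5 → Set
IsOrientedStar4 F =
  Oriented F ×
  Σ (Fin 5) λ c →
    (∀ x → x ≢ c → (F c x ≡ true ⊎ F x c ≡ true))
    × (∀ x y → x ≢ c → y ≢ c → F x y ≡ false)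

IsTournament : ∀ {n} → Digraph n → Set
IsTournament {n} D = Oriented D × (∀ (x y : Fin n) → x ≢ y → (D x y ≡ true ⊎ D y x ≡ true))

IsTransitiveTournament : ∀ {n} → Digraph n → Set
IsTransitiveTournament D = IsTournament D × Acyclic D

TT : (k : ℕ) → Digraph k
TT k i j = toℕ i <ᵇ toℕ j

Δ : ∀ {a b c} → Digraph a → Digraph b → Digraph c → Digraph (a + (b + c))
Δ {a} {b} {c} D₁ D₂ D₃ x y = go (splitAt a x) (splitAt a y)
  where
  go : Fin a ⊎ Fin (b + c) → Fin a ⊎ Fin (b + c) → Bool
  go (inj₁ u) (inj₁ v) = D₁ u v
  go (inj₁ u) (inj₂ v) with splitAt b v
  ... | inj₁ _ = true
  ... | inj₂ _ = false
  go (inj₂ u) (inj₁ v) with splitAt b u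
  ... | inj₁ _ = false
  ... | inj₂ _ = true
  go (inj₂ u) (inj₂ v) with splitAt b u | splitAt b v
  ... | inj₁ u' | inj₁ v' = D₂ u' v'
  ... | inj₁ _  | inj₂ _  = true
  ... | inj₂ _  | inj₁ _  = false
  ... | inj₂ u' | inj₂ v' = D₃ u' v'

{-# OPTIONS --safe #-}
-- For i < j < k orient the triangle ij, ik, jk of the line graph of K_N as
-- ij → ik → jk → ij.  By Ramsey's theorem every bounded colouring of the edges
-- of a large K_N has a monochromatic triangle, hence a monochromatic directed
-- 3-cycle, so these digraphs and all their completions to tournaments have
-- unbounded dichromatic number.  Both are F-free, since line graphs are claw-free
-- and tournaments have no non-adjacent vertices.  So H is a tournament, and an
-- induced subdigraph of an oriented line graph.  If H is not transitive it has a
-- 3-cycle.  Only the arcs jk → ij lower the sum of the ends, so the 3-cycle uses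
-- one of them and is then forced to be jk → ij → ik → jk; no further edge of K_N
-- meets all three of its vertices.  Hence H is the directed triangle.
module Submission where

open import Defs
open import Data.Bool using (true; false; not; _∧_; _∨_; _≟_)
open import Data.Empty using (⊥; ⊥-elim)
open import Data.Fin using (Fin; zero; suc; toℕ; fromℕ; inject₁; remQuot; combine; punchIn) renaming (_<_ to _<ᶠ_)
import Data.Fin.Properties as Fin
open import Data.List using (List; []; _∷_; length; filter; allFin)
open import Data.List.Membership.Propositional using (_∈_; lose)
open import Data.List.Membership.Propositional.Properties using (∈-filter⁺; ∈-allFin)
open import Data.List.Properties using (filter-notAll; length-tabulate)
open import Data.List.Relation.Unary.All as All using (All; []; _∷_)
open import Data.List.Relation.Unary.All.Properties using (all-filter) renaming (filter⁺ to All-filter⁺)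
open import Data.List.Relation.Unary.AllPairs using (AllPairs; []; _∷_)
import Data.List.Relation.Unary.AllPairs.Properties as AllPairs
open import Data.List.Relation.Unary.Any using (here; there)
open import Data.Nat using (ℕ; zero; suc; _≥_; _+_; _*_; _≤_; _<_; z≤n; s≤s; s≤s⁻¹)
import Data.Nat.Properties as ℕ
open import Data.Product using (_×_; ∃-syntax; _,_; proj₁; proj₂)
open import Data.Sum as Sum using (_⊎_; inj₁; inj₂; [_,_]′)
open import Function using (_∘_)
open import Function.Bundles using (mk↔ₛ′)
open import Function.Definitions using (Injective)
open import Relation.Binary.Definitions using (tri<; tri≈; tri>)
open import Relation.Binary.PropositionalEquality
open import Relation.Nullary
open import Relation.Nullary.Decidable using (dec-true; dec-false; decidable-stable; ¬?; _×-dec_; _⊎-dec_)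

does-true : ∀ {A : Set} (a? : Dec A) → does a? ≡ true → A
does-true (yes a) _ = a

true≢false : ∀ {b} → b ≡ true → b ≡ false → ⊥
true≢false refl ()

-- Ramsey's theorem for triangles

length-filter-¬ : ∀ {A : Set} {P : A → Set} (P? : ∀ x → Dec (P x)) xs →
  length xs ≡ length (filter P? xs) + length (filter (¬? ∘ P?) xs)
length-filter-¬ P? [] = refl
length-filter-¬ P? (x ∷ xs) with does (P? x)
... | true  = cong suc (length-filter-¬ P? xs)
... | false = trans (cong suc (length-filter-¬ P? xs)) (sym (ℕ.+-suc _ _))

length-filter-comm : ∀ {A : Set} {P Q : A → Set} (P? : ∀ x → Dec (P x)) (Q? : ∀ x → Dec (Q x)) xs →
  length (filter Q? (filter P? xs)) ≤ length (filter Q? xs)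
length-filter-comm P? Q? [] = z≤n
length-filter-comm P? Q? (x ∷ xs) with does (P? x)
length-filter-comm P? Q? (x ∷ xs) | true with does (Q? x)
... | true  = s≤s (length-filter-comm P? Q? xs)
... | false = length-filter-comm P? Q? xs
length-filter-comm P? Q? (x ∷ xs) | false with does (Q? x)
... | true  = ℕ.m≤n⇒m≤1+n (length-filter-comm P? Q? xs)
... | false = length-filter-comm P? Q? xs

-- Pigeonhole by induction on the list of keys: the fibre over the first key is split off, and what
-- remains has its keys in the tail and no larger fibres.
length≤fibres : ∀ {A : Set} {k} (key : A → Fin k) (cs : List (Fin k)) m xs →
  All (λ x → key x ∈ cs) xs →
  (∀ a → a ∈ cs → length (filter (λ x → key x Fin.≟ a) xs) ≤ m) →
  length xs ≤ length cs * m
length≤fibres key [] m [] _ _ = z≤n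
length≤fibres key [] m (x ∷ xs) (() ∷ _) _
length≤fibres {A} key (a ∷ cs) m xs keys∈ small = begin
  length xs                                          ≡⟨ length-filter-¬ a? xs ⟩
  length (filter a? xs) + length (filter (¬? ∘ a?) xs)
    ≤⟨ ℕ.+-mono-≤ (small a (here refl))
         (length≤fibres key cs m (filter (¬? ∘ a?) xs)
           (All.zipWith other (all-filter (¬? ∘ a?) xs , All-filter⁺ (¬? ∘ a?) keys∈))
           (λ b b∈cs → ℕ.≤-trans (length-filter-comm (¬? ∘ a?) _ xs) (small b (there b∈cs)))) ⟩
  m + length cs * m                                  ∎
  where
  open ℕ.≤-Reasoning
  a? : ∀ x → Dec (key x ≡ a)
  a? x = key x Fin.≟ a
  other : ∀ {x} → key x ≢ a × key x ∈ a ∷ cs → key x ∈ cs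
  other (≢a , here ≡a) = ⊥-elim (≢a ≡a)
  other (_ , there ∈cs) = ∈cs

All⇒AllPairs : ∀ {A : Set} {P : A → Set} {R S : A → A → Set} →
  (∀ {x y} → P x → P y → R x y → S x y) → ∀ {xs} → All P xs → AllPairs R xs → AllPairs S xs
All⇒AllPairs f [] [] = []
All⇒AllPairs f (px ∷ pxs) (Rx ∷ Rxs) =
  All.zipWith (λ (py , r) → f px py r) (pxs , Rx) ∷ All⇒AllPairs f pxs Rxs

-- Recursion of the Ramsey argument: one chosen vertex, and for each of the `suc c` colours a
-- neighbourhood in which only `c` colours survive. Without colours no two vertices can coexist,
-- hence the value 1.
ramseyBound : ℕ → ℕ
ramseyBound zero    = 1
ramseyBound (suc c) = suc (suc c * ramseyBound c)

module _ {A : Set} (_≺_ : A → A → Set) {k} (χ : A → A → Fin k)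
  (noTriangle : ∀ {x y z} → x ≺ y → y ≺ z → χ x y ≡ χ x z → χ x z ≡ χ y z → ⊥) where

  -- Sort the later vertices by the colour of their edge to `x`. Inside the fibre of `a` the colour
  -- `a` cannot recur, so induction applies with `a` struck from `cs`. A list of permitted colours
  -- lets the palette shrink without renaming colours.
  ramsey : ∀ c cs → length cs ≤ c → ∀ xs →
    AllPairs (λ x y → x ≺ y × χ x y ∈ cs) xs → length xs ≤ ramseyBound c
  ramsey c cs _ [] _ = z≤n
  ramsey zero [] _ (x ∷ ys) (x-ys ∷ _) =
    -- No colour is left for an edge from `x`, so `ys` is empty.
    s≤s (length≤fibres (χ x) [] 0 ys (All.map proj₂ x-ys) (λ _ ()))
  ramsey (suc c) cs cs≤ (x ∷ ys) (x-ys ∷ ys-ys) =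
    s≤s (ℕ.≤-trans (length≤fibres (χ x) cs (ramseyBound c) ys (All.map proj₂ x-ys) fibre≤)
                   (ℕ.*-monoˡ-≤ (ramseyBound c) cs≤))
    where
    fibre≤ : ∀ a → a ∈ cs → length (filter (λ y → χ x y Fin.≟ a) ys) ≤ ramseyBound c
    fibre≤ a a∈cs =
      ramsey c (filter ≢a? cs)
        (s≤s⁻¹ (ℕ.≤-trans (filter-notAll ≢a? cs (lose a∈cs (λ a≢a → a≢a refl))) cs≤))
        (filter a? ys)
        (All⇒AllPairs
          -- If yz had colour `a` too, then x, y, z would span a monochromatic triangle.
          (λ (x≺y , xy≡a) (x≺z , xz≡a) (y≺z , yz∈cs) →
            y≺z , ∈-filter⁺ ≢a? yz∈cs
              (λ yz≡a → noTriangle x≺y y≺z (trans xy≡a (sym xz≡a)) (trans xz≡a (sym yz≡a))))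
          (All.zip (All.map proj₁ (All-filter⁺ a? x-ys) , all-filter a? ys))
          (AllPairs.filter⁺ a? ys-ys))
      where
      a? : ∀ y → Dec (χ x y ≡ a)
      a? y = χ x y Fin.≟ a
      ≢a? : ∀ b → Dec (b ≢ a)
      ≢a? b = ¬? (b Fin.≟ a)

ramsey-Fin : ∀ {k} (χ : (i j : Fin (suc (ramseyBound k))) → Fin k) →
  ¬ (∀ {i j l} → i <ᶠ j → j <ᶠ l → χ i j ≡ χ i l → χ i l ≡ χ j l → ⊥)
ramsey-Fin {k} χ noTriangle =
  ℕ.<-irrefl refl
    (subst (_≤ ramseyBound k) (length-tabulate {n = suc (ramseyBound k)} (λ i → i))
      (ramsey _<ᶠ_ χ noTriangle k (allFin k) (ℕ.≤-reflexive (length-tabulate {n = k} (λ i → i)))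
        (allFin _) (AllPairs.tabulate⁺-< (λ i<j → i<j , ∈-allFin _))))

-- Digraphs with a directed triangle

lookup₃ : ∀ {A : Set} → A → A → A → Fin 3 → A
lookup₃ x y z zero             = x
lookup₃ x y z (suc zero)       = y
lookup₃ x y z (suc (suc zero)) = z

-- The directed triangle, written as the member of the family with both parameters equal to 1, which
-- is the form that the conclusion asks for.
C₃ : Digraph 3
C₃ = Δ (TT 1) (TT 1) (TT 1)

Triangle : ∀ {n} → Digraph n → Fin n → Fin n → Fin n → Set
Triangle D x y z = D x y ≡ true × D y z ≡ true × D z x ≡ true

triangle? : ∀ {n} (D : Digraph n) → Dec (∃[ x ] ∃[ y ] ∃[ z ] Triangle D x y z)
triangle? D = Fin.any? λ x → Fin.any? λ y → Fin.any? λ z →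
  (D x y ≟ true) ×-dec (D y z ≟ true) ×-dec (D z x ≟ true)

module _ {n} {D : Digraph n} (oriented : Oriented D) {x y z : Fin n} (△ : Triangle D x y z) where
  private
    xy = proj₁ △
    yz = proj₁ (proj₂ △)
    zx = proj₂ (proj₂ △)
    loop = proj₁ oriented
    back = proj₂ oriented

  triangle-arcs : ∀ i j → D (lookup₃ x y z i) (lookup₃ x y z j) ≡ C₃ i j
  triangle-arcs zero             zero             = loop x
  triangle-arcs zero             (suc zero)       = xy
  triangle-arcs zero             (suc (suc zero)) = back z x zx
  triangle-arcs (suc zero)       zero             = back x y xy
  triangle-arcs (suc zero)       (suc zero)       = loop y
  triangle-arcs (suc zero)       (suc (suc zero)) = yz
  triangle-arcs (suc (suc zero)) zero             = zx
  triangle-arcs (suc (suc zero)) (suc zero)       = back y z yz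
  triangle-arcs (suc (suc zero)) (suc (suc zero)) = loop z

  arc⇒≢ : ∀ {u v} → D u v ≡ true → u ≢ v
  arc⇒≢ {u} uv refl = true≢false uv (loop u)

  triangle-injective : Injective _≡_ _≡_ (lookup₃ x y z)
  triangle-injective {zero}         {zero}         _ = refl
  triangle-injective {zero}         {suc zero}     e = ⊥-elim (arc⇒≢ xy e)
  triangle-injective {zero}         {suc (suc zero)} e = ⊥-elim (arc⇒≢ zx (sym e))
  triangle-injective {suc zero}     {zero}         e = ⊥-elim (arc⇒≢ xy (sym e))
  triangle-injective {suc zero}     {suc zero}     _ = refl
  triangle-injective {suc zero}     {suc (suc zero)} e = ⊥-elim (arc⇒≢ yz e)
  triangle-injective {suc (suc zero)} {zero}       e = ⊥-elim (arc⇒≢ zx e)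
  triangle-injective {suc (suc zero)} {suc zero}   e = ⊥-elim (arc⇒≢ yz (sym e))
  triangle-injective {suc (suc zero)} {suc (suc zero)} _ = refl

  triangle⇒cycle : (P : Fin n → Set) → P x → P y → P z → CycleIn D P
  -- `CycleIn` records the length minus two, so 1 encodes a 3-cycle.
  triangle⇒cycle P px py pz = 1 , lookup₃ x y z , triangle-injective , inP , step , zx
    where
    inP : ∀ i → P (lookup₃ x y z i)
    inP zero             = px
    inP (suc zero)       = py
    inP (suc (suc zero)) = pz
    step : ∀ (i : Fin 2) → D (lookup₃ x y z (inject₁ i)) (lookup₃ x y z (suc i)) ≡ true
    step zero       = xy
    step (suc zero) = yz

  isoC₃ : (∀ w → w ≡ x ⊎ w ≡ y ⊎ w ≡ z) → Isomorphic D C₃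
  -- One inverse law is built into `position`; the other follows from it because `from` is
  -- injective.
  isoC₃ cover = mk↔ₛ′ to from (λ a → triangle-injective (from∘to (from a))) from∘to , arcs
    where
    from = lookup₃ x y z
    position : ∀ w → ∃[ a ] from a ≡ w
    position w with cover w
    ... | inj₁ refl        = zero , refl
    ... | inj₂ (inj₁ refl) = suc zero , refl
    ... | inj₂ (inj₂ refl) = suc (suc zero) , refl
    to : Fin n → Fin 3
    to w = proj₁ (position w)
    from∘to : ∀ w → from (to w) ≡ w
    from∘to w = proj₂ (position w)
    arcs : ∀ u v → C₃ (to u) (to v) ≡ D u v
    arcs u v = trans (sym (triangle-arcs (to u) (to v))) (cong₂ D (from∘to u) (from∘to v))

-- Walking along a cycle, the first vertex sends an arc to every later one: an arc back to it would
-- close a directed triangle. At the last vertex this contradicts the closing arc.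
triangle-free⇒acyclic : ∀ {n} {D : Digraph n} → IsTournament D →
  ¬ (∃[ x ] ∃[ y ] ∃[ z ] Triangle D x y z) → Acyclic D
triangle-free⇒acyclic {n} {D} ((_ , back) , total) noTriangle (l , g , g-inj , _ , step , close) =
  true≢false close (back _ _ (reach l g g-inj step (fromℕ l)))
  where
  reach : ∀ l (g : Fin (suc (suc l)) → Fin n) → Injective _≡_ _≡_ g →
    (∀ (i : Fin (suc l)) → D (g (inject₁ i)) (g (suc i)) ≡ true) →
    ∀ i → D (g zero) (g (suc i)) ≡ true
  reach l g g-inj step zero = step zero
  reach (suc l) g g-inj step (suc i) with total (g zero) (g (suc (suc i))) (λ e → Fin.0≢1+n (g-inj e))
  ... | inj₁ arc = arc
  ... | inj₂ arc = ⊥-elim (noTriangle (_ , _ , _ , before , step (suc i) , arc))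
    where
    before : D (g zero) (g (inject₁ (suc i))) ≡ true
    -- Dropping the last vertex of the path leaves the same start and makes the recursion
    -- structural.
    before = reach l (g ∘ inject₁) (Fin.inject₁-injective ∘ g-inj) (step ∘ inject₁) i

-- The oriented line graph of a complete graph

module _ {N : ℕ} where

  IsBack : Fin N × Fin N → Fin N × Fin N → Set
  IsBack (a , b) (c , d) = a ≡ d × c <ᶠ a × a <ᶠ b

  -- For i < j < k the summands are ij → ik, ik → jk and jk → ij. Below, `top` and `bot` are named
  -- after the end of the edge that moves up.
  Arc : Fin N × Fin N → Fin N × Fin N → Set
  Arc p@(a , b) q@(c , d) =
      (a ≡ c × a <ᶠ b × b <ᶠ d)
    ⊎ (b ≡ d × a <ᶠ c × c <ᶠ b)
    ⊎ IsBack p q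

  pattern top  i<j j<k = inj₁ (refl , i<j , j<k)
  pattern bot  i<j j<k = inj₂ (inj₁ (refl , i<j , j<k))
  pattern back i<j j<k = inj₂ (inj₂ (refl , i<j , j<k))

  arc? : ∀ p q → Dec (Arc p q)
  arc? (a , b) (c , d) =
          ((a Fin.≟ c) ×-dec (a Fin.<? b) ×-dec (b Fin.<? d))
    ⊎-dec ((b Fin.≟ d) ×-dec (a Fin.<? c) ×-dec (c Fin.<? b))
    ⊎-dec ((a Fin.≟ d) ×-dec (c Fin.<? a) ×-dec (a Fin.<? b))

  private
    <-trans : ∀ {i j k : Fin N} → i <ᶠ j → j <ᶠ k → i <ᶠ k
    <-trans {i} {j} {k} = Fin.<-trans {i = i} {j} {k}

    <-irrefl : ∀ {i : Fin N} → ¬ (i <ᶠ i)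
    <-irrefl {i} = Fin.<-irrefl {x = i} refl

    <-asym : ∀ {i j : Fin N} → i <ᶠ j → ¬ (j <ᶠ i)
    <-asym {i} {j} = Fin.<-asym {x = i} {j}

  arc-asym : ∀ p q → Arc p q → ¬ Arc q p
  arc-asym (a , b) (c , d) (top _ b<d)    (top _ d<b)    = <-asym b<d d<b
  arc-asym (a , b) (c , d) (top _ b<d)    (bot a<a _)    = <-irrefl a<a
  arc-asym (a , b) (c , d) (top a<b _)    (back a<a _)   = <-irrefl a<a
  arc-asym (a , b) (c , d) (bot _ _)      (top _ b<b)    = <-irrefl b<b
  arc-asym (a , b) (c , d) (bot a<c _)    (bot c<a _)    = <-asym a<c c<a
  arc-asym (a , b) (c , d) (bot a<b b<b)  (back _ _)     = <-irrefl b<b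
  arc-asym (a , b) (c , d) (back c<c _)   (top _ _)      = <-irrefl c<c
  arc-asym (a , b) (c , d) (back _ a<a)   (bot _ _)      = <-irrefl a<a
  arc-asym (a , b) (c , d) (back c<a a<c) (back _ _)     = <-asym c<a a<c

  Proper : Fin N × Fin N → Set
  Proper (a , b) = a <ᶠ b

  arc⇒properˡ : ∀ {p q} → Arc p q → Proper p
  arc⇒properˡ (top i<j j<k)  = i<j
  arc⇒properˡ (bot i<j j<k)  = <-trans i<j j<k
  arc⇒properˡ (back i<j j<k) = j<k

  arc⇒properʳ : ∀ {p q} → Arc p q → Proper q
  arc⇒properʳ (top i<j j<k)  = <-trans i<j j<k
  arc⇒properʳ (bot i<j j<k)  = j<k
  arc⇒properʳ (back i<j j<k) = i<j

  Adj : Fin N × Fin N → Fin N × Fin N → Set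
  Adj p q = Arc p q ⊎ Arc q p

  _∈ᵉ_ : Fin N → Fin N × Fin N → Set
  v ∈ᵉ (a , b) = v ≡ a ⊎ v ≡ b

  adj⇒proper : ∀ {p q} → Adj p q → Proper q
  adj⇒proper = [ arc⇒properʳ , arc⇒properˡ ]′

  adj⇒meets : ∀ {x y q} → Adj (x , y) q → x ∈ᵉ q ⊎ y ∈ᵉ q
  adj⇒meets (inj₁ (top _ _))  = inj₁ (inj₁ refl)
  adj⇒meets (inj₁ (bot _ _))  = inj₂ (inj₂ refl)
  adj⇒meets (inj₁ (back _ _)) = inj₁ (inj₂ refl)
  adj⇒meets (inj₂ (top _ _))  = inj₁ (inj₁ refl)
  adj⇒meets (inj₂ (bot _ _))  = inj₂ (inj₂ refl)
  adj⇒meets (inj₂ (back _ _)) = inj₂ (inj₁ refl)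

  -- Together with `adj⇒meets` this makes the underlying graph on proper pairs the line graph of
  -- K_N. When the shared vertex is the lower end of both or the upper end of both, comparing the
  -- other ends gives the direction.
  meet⇒adj : ∀ {v p q} → Proper p → Proper q → v ∈ᵉ p → v ∈ᵉ q → p ≢ q → Adj p q
  meet⇒adj {p = a , b} {c , d} a<b c<d (inj₁ refl) (inj₁ refl) p≢q with Fin.<-cmp b d
  ... | tri< b<d _ _  = inj₁ (top a<b b<d)
  ... | tri≈ _ refl _ = ⊥-elim (p≢q refl)
  ... | tri> _ _ d<b  = inj₂ (top c<d d<b)
  meet⇒adj a<b c<d (inj₁ refl) (inj₂ refl) p≢q = inj₁ (back c<d a<b)
  meet⇒adj a<b c<d (inj₂ refl) (inj₁ refl) p≢q = inj₂ (back a<b c<d)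
  meet⇒adj {p = a , b} {c , d} a<b c<d (inj₂ refl) (inj₂ refl) p≢q with Fin.<-cmp a c
  ... | tri< a<c _ _  = inj₁ (bot a<c c<d)
  ... | tri≈ _ refl _ = ⊥-elim (p≢q refl)
  ... | tri> _ _ c<a  = inj₂ (bot c<a a<b)

  endpoints : ∀ {x y s} → x <ᶠ y → Proper s → x ∈ᵉ s → y ∈ᵉ s → s ≡ (x , y)
  endpoints x<y s-proper (inj₁ refl) (inj₁ refl) = ⊥-elim (<-irrefl x<y)
  endpoints x<y s-proper (inj₁ refl) (inj₂ refl) = refl
  endpoints x<y s-proper (inj₂ refl) (inj₁ refl) = ⊥-elim (<-asym x<y s-proper)
  endpoints x<y s-proper (inj₂ refl) (inj₂ refl) = ⊥-elim (<-irrefl x<y)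

  -- An edge that meets jk, ij and ik contains two of i, j, k. The edges are listed in the order of
  -- the directed cycle jk → ij → ik, to fit `Dominated`.
  common-neighbour : ∀ {i j k s} → i <ᶠ j → j <ᶠ k →
    Adj (j , k) s → Adj (i , j) s → Adj (i , k) s →
    s ≡ (j , k) ⊎ s ≡ (i , j) ⊎ s ≡ (i , k)
  common-neighbour i<j j<k jk ij ik with adj⇒meets jk
  ... | inj₁ j∈s with adj⇒meets ik
  ...   | inj₁ i∈s = inj₂ (inj₁ (endpoints i<j (adj⇒proper ij) i∈s j∈s))
  ...   | inj₂ k∈s = inj₁ (endpoints j<k (adj⇒proper ij) j∈s k∈s)
  common-neighbour i<j j<k jk ij ik | inj₂ k∈s with adj⇒meets ij
  ...   | inj₁ i∈s = inj₂ (inj₂ (endpoints (<-trans i<j j<k) (adj⇒proper ij) i∈s k∈s))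
  ...   | inj₂ j∈s = inj₁ (endpoints j<k (adj⇒proper ij) j∈s k∈s)

  Dominated : (p q r : Fin N × Fin N) → Set
  Dominated p q r = ∀ {s} → Adj p s → Adj q s → Adj r s → s ≡ p ⊎ s ≡ q ⊎ s ≡ r

  rotate : ∀ {p q r} → Dominated p q r → Dominated q r p
  rotate dom aq ar ap with dom ap aq ar
  ... | inj₁ e        = inj₂ (inj₂ e)
  ... | inj₂ (inj₁ e) = inj₁ e
  ... | inj₂ (inj₂ e) = inj₂ (inj₁ e)

  -- With p = jk and q = ij, only a `top` arc followed by a `bot` arc returns to p, which forces r =
  -- ik; the other eight combinations violate i < j < k.
  back-triangle : ∀ {p q r} → IsBack p q → Arc q r → Arc r p → Dominated p q r
  back-triangle (refl , i<j , j<k) (top _ j<l)    (top _ _)      = ⊥-elim (<-irrefl i<j)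
  back-triangle (refl , i<j , j<k) (top _ _)      (bot _ _)      = common-neighbour i<j j<k
  back-triangle (refl , i<j , j<k) (top _ _)      (back j<i _)   = ⊥-elim (<-asym i<j j<i)
  back-triangle (refl , i<j , j<k) (bot _ l<j)    (top _ _)      = ⊥-elim (<-irrefl l<j)
  back-triangle (refl , i<j , j<k) (bot _ _)      (bot _ _)      = ⊥-elim (<-irrefl j<k)
  back-triangle (refl , i<j , j<k) (bot _ l<j)    (back _ _)     = ⊥-elim (<-asym j<k l<j)
  back-triangle (refl , i<j , j<k) (back l<i _)   (top _ _)      = ⊥-elim (<-asym i<j l<i)
  back-triangle (refl , i<j , j<k) (back _ _)     (bot _ _)      = ⊥-elim (<-asym i<j j<k)
  back-triangle (refl , i<j , j<k) (back l<i _)   (back _ _)     = ⊥-elim (<-asym (<-trans i<j j<k) l<i)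

  weight : Fin N × Fin N → ℕ
  weight (a , b) = toℕ a + toℕ b

  back-or-heavier : ∀ {p q} → Arc p q → IsBack p q ⊎ weight p < weight q
  back-or-heavier {a , b} {c , d} (top _ b<d) = inj₂ (ℕ.+-monoʳ-< (toℕ a) b<d)
  back-or-heavier {a , b} {c , d} (bot a<c _) = inj₂ (ℕ.+-monoˡ-< (toℕ b) a<c)
  back-or-heavier (inj₂ (inj₂ is-back))       = inj₁ is-back

  -- The weight cannot rise all the way round a cycle, so some arc is a back arc; rotation brings it
  -- to the front.
  triangle-dominated : ∀ {p q r} → Arc p q → Arc q r → Arc r p → Dominated p q r
  triangle-dominated pq qr rp with back-or-heavier pq | back-or-heavier qr | back-or-heavier rp
  ... | inj₁ b   | _        | _        = back-triangle b qr rp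
  ... | inj₂ _   | inj₁ b   | _        = rotate (rotate (back-triangle b rp pq))
  ... | inj₂ _   | inj₂ _   | inj₁ b   = rotate (back-triangle b pq qr)
  ... | inj₂ p<q | inj₂ q<r | inj₂ r<p = ⊥-elim (ℕ.<-irrefl refl (ℕ.<-trans p<q (ℕ.<-trans q<r r<p)))

-- A pair (i , j) with i < j stands for the edge ij of K_N; the other pairs are isolated vertices.
lineDigraph : ∀ N → Digraph (N * N)
lineDigraph N x y = does (arc? (remQuot {N} N x) (remQuot {N} N y))

module _ {N : ℕ} where
  private
    L = lineDigraph N

    ends : Fin (N * N) → Fin N × Fin N
    ends = remQuot {N} N

  ends-injective : ∀ {x y} → ends x ≡ ends y → x ≡ y
  ends-injective {x} {y} e = trans (sym (Fin.combine-remQuot {N} N x))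
    (trans (cong (λ (i , j) → combine i j) e) (Fin.combine-remQuot {N} N y))

  L⇒arc : ∀ {x y} → L x y ≡ true → Arc (ends x) (ends y)
  L⇒arc {x} {y} = does-true (arc? (ends x) (ends y))

  L-adj : ∀ {x y} → L x y ≡ true ⊎ L y x ≡ true → Adj (ends x) (ends y)
  L-adj (inj₁ xy) = inj₁ (L⇒arc xy)
  L-adj (inj₂ yx) = inj₂ (L⇒arc yx)

  arc⇒L : ∀ {i j k l : Fin N} → Arc (i , j) (k , l) → L (combine i j) (combine k l) ≡ true
  arc⇒L {i} {j} {k} {l} arc = dec-true (arc? _ _)
    (subst₂ Arc (sym (Fin.remQuot-combine i j)) (sym (Fin.remQuot-combine k l)) arc)

  lineDigraph-oriented : Oriented L
  lineDigraph-oriented =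
    (λ x → dec-false (arc? (ends x) (ends x)) (λ a → arc-asym _ _ a a)) ,
    (λ x y xy → dec-false (arc? (ends y) (ends x)) (arc-asym _ _ (L⇒arc xy)))

  -- Each leaf meets the centre, an edge of K_N, in one of its two ends. By pigeonhole two of the
  -- four leaves share an end and are therefore adjacent.
  lineDigraph-starFree : ∀ {F} → IsOrientedStar4 F → Free F L
  lineDigraph-starFree {F} (_ , c , spoke , non-adj) (f , f-inj , f-arc) =
    let _ , _ , i<j , same = Fin.pigeonhole {2} {4} (s≤s (s≤s (s≤s z≤n))) (λ i → side (adj⇒meets (spoke-adj i)))
    in clash i<j same
    where
    leaf : Fin 4 → Fin (N * N)
    leaf i = f (punchIn c i)
    spoke-adj : ∀ i → Adj (ends (f c)) (ends (leaf i))
    spoke-adj i with spoke (punchIn c i) (Fin.punchInᵢ≢i c i)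
    ... | inj₁ out = L-adj (inj₁ (trans (f-arc _ _) out))
    ... | inj₂ inn = L-adj (inj₂ (trans (f-arc _ _) inn))
    -- Only the choice of the end is kept, as the pigeonhole class of a leaf.
    side : ∀ {A B : Set} → A ⊎ B → Fin 2
    side = [ (λ _ → zero) , (λ _ → suc zero) ]′
    no-arc : ∀ i j → ¬ Arc (ends (leaf i)) (ends (leaf j))
    no-arc i j arc = true≢false (dec-true (arc? _ _) arc)
      (trans (f-arc _ _) (non-adj _ _ (Fin.punchInᵢ≢i c i) (Fin.punchInᵢ≢i c j)))
    common : ∀ {i j v} → i <ᶠ j → v ∈ᵉ ends (leaf i) → v ∈ᵉ ends (leaf j) → ⊥
    common {i} {j} i<j v∈i v∈j = [ no-arc i j , no-arc j i ]′
      (meet⇒adj (adj⇒proper (spoke-adj i)) (adj⇒proper (spoke-adj j)) v∈i v∈j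
        (λ e → Fin.<-irrefl (Fin.punchIn-injective c i j (f-inj (ends-injective e))) i<j))
    clash : ∀ {i j} → i <ᶠ j → side (adj⇒meets (spoke-adj i)) ≡ side (adj⇒meets (spoke-adj j)) → ⊥
    clash {i} {j} i<j same with adj⇒meets (spoke-adj i) | adj⇒meets (spoke-adj j)
    ... | inj₁ a∈i | inj₁ a∈j = common i<j a∈i a∈j
    ... | inj₂ b∈i | inj₂ b∈j = common i<j b∈i b∈j

  lineDigraph-dominated : ∀ {x y z w} → Triangle L x y z →
    L x w ≡ true ⊎ L w x ≡ true → L y w ≡ true ⊎ L w y ≡ true → L z w ≡ true ⊎ L w z ≡ true →
    w ≡ x ⊎ w ≡ y ⊎ w ≡ z
  lineDigraph-dominated (xy , yz , zx) xw yw zw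
    with triangle-dominated (L⇒arc xy) (L⇒arc yz) (L⇒arc zx) (L-adj xw) (L-adj yw) (L-adj zw)
  ... | inj₁ e        = inj₁ (ends-injective e)
  ... | inj₂ (inj₁ e) = inj₂ (inj₁ (ends-injective e))
  ... | inj₂ (inj₂ e) = inj₂ (inj₂ (ends-injective e))

-- Lower bound on the dichromatic number

_⊑_ : ∀ {n} → Digraph n → Digraph n → Set
D ⊑ E = ∀ x y → D x y ≡ true → E x y ≡ true

-- A vertex colouring of `G` colours the edges of K_N, and a monochromatic triangle i < j < l yields
-- the monochromatic cycle ij → il → jl → ij. Extra arcs in `G` do not destroy it, so the bound
-- covers the completions as well.
⊑lineDigraph-dichromatic : ∀ k {G} → Oriented G → lineDigraph (suc (ramseyBound k)) ⊑ G →
  ¬ DichromaticAtMost G k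
⊑lineDigraph-dichromatic k {G} oriented L⊑G (col , acyclic) =
  ramsey-Fin (λ i j → col (combine i j)) λ {i} {j} {l} i<j j<l ij≡il il≡jl →
    acyclic (col (combine i l))
      (triangle⇒cycle oriented
        ( arc i j i l (top i<j j<l)
        , arc i l j l (bot i<j j<l)
        , arc j l i j (back i<j j<l))
        (λ v → col v ≡ col (combine i l)) ij≡il refl (sym il≡jl))
  where
  arc : ∀ a b c d → Arc (a , b) (c , d) → G (combine a b) (combine c d) ≡ true
  arc a b c d abcd = L⊑G _ _ (arc⇒L {i = a} {b} {c} {d} abcd)

-- Completion to a tournament

-- The order of the indices serves to orient the pairs that `D` leaves non-adjacent.
complete : ∀ {n} → Digraph n → Digraph n
complete D x y = D x y ∨ (not (D y x) ∧ does (x Fin.<? y))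

module _ {n} {D : Digraph n} where

  ⊑complete : D ⊑ complete D
  ⊑complete x y xy rewrite xy = refl

  complete-tournament : Oriented D → IsTournament (complete D)
  complete-tournament (loop , anti) = (loop′ , anti′) , total
    where
    loop′ : ∀ x → complete D x x ≡ false
    loop′ x rewrite loop x = dec-false (x Fin.<? x) (Fin.<-irrefl refl)
    anti′ : ∀ x y → complete D x y ≡ true → complete D y x ≡ false
    anti′ x y with D x y in xy | D y x in yx
    ... | true  | true  = λ _ → ⊥-elim (true≢false yx (anti x y xy))
    ... | true  | false = λ _ → refl
    ... | false | true  = λ ()
    ... | false | false = λ x<y → dec-false (y Fin.<? x) (Fin.<-asym {x = x} {y} (does-true (x Fin.<? y) x<y))
    total : ∀ x y → x ≢ y → complete D x y ≡ true ⊎ complete D y x ≡ true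
    total x y x≢y with D x y | D y x
    ... | true  | _     = inj₁ refl
    ... | false | true  = inj₂ refl
    ... | false | false with Fin.<-cmp x y
    ...   | tri< x<y _ _ = inj₁ (dec-true (x Fin.<? y) x<y)
    ...   | tri≈ _ x≡y _ = ⊥-elim (x≢y x≡y)
    ...   | tri> _ _ y<x = inj₂ (dec-true (y Fin.<? x) y<x)

contained-total : ∀ {h n} {H : Digraph h} {D : Digraph n} → IsTournament D → Contains H D →
  ∀ x y → x ≢ y → H x y ≡ true ⊎ H y x ≡ true
contained-total (_ , total) (f , f-inj , f-arc) x y x≢y with total (f x) (f y) (λ e → x≢y (f-inj e))
... | inj₁ arc = inj₁ (trans (sym (f-arc x y)) arc)
... | inj₂ arc = inj₂ (trans (sym (f-arc y x)) arc)

-- Two leaves of the star would have to be adjacent; `punchIn c` supplies them by skipping the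
-- centre.
tournament-starFree : ∀ {F n} {D : Digraph n} → IsOrientedStar4 F → IsTournament D → Free F D
tournament-starFree (_ , c , _ , non-adj) tournament contained
  with contained-total tournament contained u v (λ e → Fin.0≢1+n (Fin.punchIn-injective c _ _ e))
  where
  u = punchIn c zero
  v = punchIn c (suc zero)
... | inj₁ arc = true≢false arc (non-adj _ _ (Fin.punchInᵢ≢i c _) (Fin.punchInᵢ≢i c _))
... | inj₂ arc = true≢false arc (non-adj _ _ (Fin.punchInᵢ≢i c _) (Fin.punchInᵢ≢i c _))

-- Classification of `H`

theorem1p6 : (F : Digraph 5) → IsOrientedStar4 F →
    ∀ {h : ℕ} (H : Digraph h) → Oriented H → ChiFinite₂ H F →
    IsTransitiveTournament H
    ⊎ (∃[ m ] ∃[ m' ] (m ≥ 1 × m' ≥ 1 × Isomorphic H (Δ (TT 1) (TT m) (TT m'))))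
theorem1p6 F star {h} H oriented (c , bounded) = classify (triangle? H)
  where
  L = lineDigraph (suc (ramseyBound c))

  -- `L` is chosen so large that `c` colours fail. This yields a copy of `H` only under double
  -- negation, which suffices for the decidable goals of `total` and `covers`.
  unavoidable : ∀ {G} → Oriented G → Free F G → L ⊑ G → ¬ Free H G
  unavoidable G-oriented F-free L⊑G H-free =
    ⊑lineDigraph-dichromatic c G-oriented L⊑G (bounded _ _ G-oriented H-free F-free)

  completion = complete-tournament (lineDigraph-oriented {suc (ramseyBound c)})

  total : ∀ x y → x ≢ y → H x y ≡ true ⊎ H y x ≡ true
  -- `H` occurs in the completed tournament, so its vertices are pairwise adjacent.
  total x y x≢y = decidable-stable ((H x y ≟ true) ⊎-dec (H y x ≟ true)) λ non-adj →
    unavoidable (proj₁ completion) (tournament-starFree star completion) ⊑complete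
      (λ contained → non-adj (contained-total completion contained x y x≢y))

  covers : ∀ {x y z} → Triangle H x y z → ∀ w → w ≡ x ⊎ w ≡ y ⊎ w ≡ z
  -- `H` also occurs in `L` itself. A further vertex would by `total` be adjacent to the whole
  -- triangle, and `lineDigraph-dominated` excludes this.
  covers {x} {y} {z} (xy , yz , zx) w =
    decidable-stable ((w Fin.≟ x) ⊎-dec (w Fin.≟ y) ⊎-dec (w Fin.≟ z)) λ outside →
    unavoidable lineDigraph-oriented (lineDigraph-starFree star) (λ _ _ arc → arc) λ (f , f-inj , f-arc) →
    let image : ∀ {u v} → H u v ≡ true → L (f u) (f v) ≡ true
        image = trans (f-arc _ _)
        adj : ∀ u → w ≢ u → L (f u) (f w) ≡ true ⊎ L (f w) (f u) ≡ true
        adj u w≢u = Sum.map image image (total u w (w≢u ∘ sym))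
    in outside (Sum.map f-inj (Sum.map f-inj f-inj)
         (lineDigraph-dominated (image xy , image yz , image zx)
           (adj x (outside ∘ inj₁)) (adj y (outside ∘ inj₂ ∘ inj₁)) (adj z (outside ∘ inj₂ ∘ inj₂))))

  classify : Dec (∃[ x ] ∃[ y ] ∃[ z ] Triangle H x y z) → IsTransitiveTournament H
    ⊎ (∃[ m ] ∃[ m' ] (m ≥ 1 × m' ≥ 1 × Isomorphic H (Δ (TT 1) (TT m) (TT m'))))
  -- The triangle is all of `H`, so both parameters are 1.
  classify (yes (x , y , z , △)) = inj₂ (1 , 1 , s≤s z≤n , s≤s z≤n , isoC₃ oriented △ (covers △))
  classify (no noTriangle)       = inj₁ ((oriented , total) , triangle-free⇒acyclic (oriented , total) noTriangle)
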